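{- Let $c,d\in\mathbb{N}$, $I=\mathbb{N}^d\times[c]$, $I_n=[n]^d\times[c]$. Let $\mathfrak{M}=(M_n)_{n\ge1}$ be a $\mathrm{Sym}$-invariant chain of monoids with $M_n\subseteq\mathbb{Z}_{\ge0}^{(I_n)}$ for all $n$, and let $M=\bigcup_{n\ge1}M_n$. Then the following are equivalent: (i) $\mathfrak{M}$ stabilizes (i.e. there is $p\in\mathbb{N}$ with $M_n=\mathbb{Z}_{\ge0}\mathrm{Sym}(n)(M_m)$ for all $n\ge m\ge p$) and $M_n$ is finitely generated for all sufficiently large $n$; (ii) there exist $p\in\mathbb{N}$ and a finite equivariant Hilbert basis $\mathcal{H}_p$ of $M_p$ that is also an equivariant Hilbert basis of $M_n$ for all $n\ge p$; (iii) there exist $q,q'\in\mathbb{N}$ such that for all $n\ge q$: (a) $M_n=M\cap\mathbb{Z}^{(I_n)}$, and (b) $M_n$ has a finite Hilbert basis consisting of elements of support size at most $q'$; (iv) $M$ has a finite equivariant Hilbert basis.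
   Context: $\mathbb{N}=\{1,2,\dots\}$. $\mathbb{Z}^{(I)}$ is the free abelian group with basis $I$, $\mathbb{Z}_{\ge0}^{(I)}$ its nonnegative vectors; $\mathbb{Z}^{(I_n)}\subseteq\mathbb{Z}^{(I)}$ by extension by zero. Support size = number of nonzero entries. For a set $A$, $\mathbb{Z}_{\ge0}A$ is the set of finite $\mathbb{Z}_{\ge0}$-linear combinations of elements of $A$. A Hilbert basis of a monoid $M$ is a minimal generating set (with respect to $\mathbb{Z}_{\ge0}$-combinations). $\mathrm{Sym}(n)$ is the symmetric group on $[n]$, embedded in $\mathrm{Sym}(n+1)$ as stabilizer of $n+1$; $\mathrm{Sym}=\bigcup_n\mathrm{Sym}(n)$ acts on $\mathbb{Z}^{(I)}$ by linear extension of $\sigma(\mathbf{e}_{(i_1,\dots,i_d),j})=\mathbf{e}_{(\sigma(i_1),\dots,\sigma(i_d)),j}$, restricting to $\mathrm{Sym}(n)$ on $\mathbb{Z}^{(I_n)}$; $G(A)=\{\sigma(\mathbf{u})\mid\sigma\in G,\mathbf{u}\in A\}$. A $\mathrm{Sym}$-invariant chain of monoids is $(M_n)_{n\ge1}$ with $M_n\subseteq\mathbb{Z}^{(I_n)}$ a monoid, $M_m\subseteq M_n$ for $m\le n$, each $M_n$ $\mathrm{Sym}(n)$-invariant. $\mathcal{H}\subseteq M_n$ (resp. $\subseteq M$) is an equivariant Hilbert basis if $\mathrm{Sym}(n)(\mathcal{H})$ (resp. $\mathrm{Sym}(\mathcal{H})$) is a Hilbert basis. -}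

module Defs where

open import Data.Nat using (ℕ; _≤_; _<_)
import Data.Nat.Properties as ℕ
open import Data.Integer using (ℤ; +_; 0ℤ; 1ℤ) renaming (_+_ to _+ᶻ_; _*_ to _*ᶻ_; _≤_ to _≤ᶻ_)
import Data.Integer.Properties as ℤ
open import Data.Fin using (Fin)
import Data.Fin.Properties as Fin
open import Data.Vec using (Vec)
import Data.Vec as Vec
import Data.Vec.Properties as Vec
open import Data.Vec.Relation.Unary.All using () renaming (All to Allᵛ)
open import Data.List using (List; []; _∷_; _++_; length; map; foldr; filter; deduplicate)
open import Data.List.Relation.Unary.All using (All)
open import Data.List.Relation.Unary.Any using (here)
open import Data.List.Membership.Propositional using (_∉_) renaming (_∈_ to _∈ˡ_)
open import Data.List.Membership.Propositional.Properties using (∈-map⁺; ∈-++⁺ˡ; ∈-++⁺ʳ)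
import Data.List.Membership.Setoid as SetoidMembership
open import Data.Product using (∃-syntax; _×_; _,_)
import Data.Product.Properties as Product
open import Function using (_∘_; _↔_; Inverse)
open import Level using (0ℓ)
open import Relation.Binary.Bundles using (Setoid)
open import Relation.Binary.Definitions using (DecidableEquality)
open import Relation.Binary.PropositionalEquality using (_≡_; _≢_; refl; sym; trans; cong; cong₂; subst)
open import Relation.Nullary using (yes; no; ¬?; contradiction)
open import Relation.Unary using (Pred)
import Relation.Unary as Unary

infix  4 _≈_ _∈_ _⊆_ _≐_
infixl 6 _⊕_
infixr 7 _⊙_ _∩_

-- ℕ^d × [c].  Positions are counted from 0, so that [n] is {0, …, n-1}.
Index : ℕ → ℕ → Set
Index c d = Vec ℕ d × Fin c

_≟ᴵ_ : ∀ {c d} → DecidableEquality (Index c d)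
_≟ᴵ_ = Product.≡-dec (Vec.≡-dec ℕ._≟_) Fin._≟_

-- [n]^d × [c] as a subset of ℕ^d × [c].
Below : ∀ {c d} → ℕ → Pred (Index c d) 0ℓ
Below n (is , _) = Allᵛ (_< n) is

-- The free abelian group ℤ^(I) as finitely supported functions I → ℤ.  The
-- list `bound` may contain repetitions and zeros of `coeff`; it is not part of
-- the identity of a vector, and equality of vectors is _≈_.
record Vector (c d : ℕ) : Set where
  field
    coeff    : Index c d → ℤ
    bound    : List (Index c d)
    vanishes : ∀ x → x ∉ bound → coeff x ≡ 0ℤ

open Vector public

private
  variable
    c d : ℕ

_≈_ : Vector c d → Vector c d → Set
u ≈ v = ∀ x → coeff u x ≡ coeff v x

vectorSetoid : ℕ → ℕ → Setoid 0ℓ 0ℓ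
vectorSetoid c d = record
  { Carrier       = Vector c d
  ; _≈_           = _≈_
  ; isEquivalence = record
    { refl  = λ _ → refl
    ; sym   = λ p x → sym (p x)
    ; trans = λ p q x → trans (p x) (q x)
    }
  }

𝟎 : Vector c d
𝟎 = record { coeff = λ _ → 0ℤ ; bound = [] ; vanishes = λ _ _ → refl }

_⊕_ : Vector c d → Vector c d → Vector c d
u ⊕ v = record
  { coeff    = λ x → coeff u x +ᶻ coeff v x
  ; bound    = bound u ++ bound v
  ; vanishes = λ x x∉ → cong₂ _+ᶻ_
      (vanishes u x (x∉ ∘ ∈-++⁺ˡ)) (vanishes v x (x∉ ∘ ∈-++⁺ʳ (bound u)))
  }

_⊙_ : ℕ → Vector c d → Vector c d
k ⊙ u = record
  { coeff    = λ x → + k *ᶻ coeff u x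
  ; bound    = bound u
  ; vanishes = λ x x∉ → trans (cong (+ k *ᶻ_) (vanishes u x x∉)) (ℤ.*-zeroʳ (+ k))
  }

𝐞 : Index c d → Vector c d
𝐞 {c} {d} y = record { coeff = δ ; bound = y ∷ [] ; vanishes = δ-vanishes }
  where
  δ : Index c d → ℤ
  δ x with x ≟ᴵ y
  ... | yes _ = 1ℤ
  ... | no  _ = 0ℤ
  δ-vanishes : ∀ x → x ∉ y ∷ [] → δ x ≡ 0ℤ
  δ-vanishes x x∉ with x ≟ᴵ y
  ... | yes x≡y = contradiction (here x≡y) x∉
  ... | no  _   = refl

support : Vector c d → List (Index c d)
support u = deduplicate _≟ᴵ_ (filter (λ x → ¬? (coeff u x ℤ.≟ 0ℤ)) (bound u))

supportSize : Vector c d → ℕ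
supportSize u = length (support u)

-- Subsets of ℤ^(I): predicates that do not distinguish equal vectors.
record Subset (c d : ℕ) : Set₁ where
  field
    member : Pred (Vector c d) 0ℓ
    resp   : ∀ {u v} → u ≈ v → member u → member v

open Subset public

_∈_ : Vector c d → Subset c d → Set
u ∈ A = member A u

_⊆_ : Subset c d → Subset c d → Set
A ⊆ B = member A Unary.⊆ member B

_≐_ : Subset c d → Subset c d → Set
A ≐ B = member A Unary.≐ member B

_∩_ : Subset c d → Subset c d → Subset c d
A ∩ B = record
  { member = member A Unary.∩ member B
  ; resp   = λ u≈v (u∈A , u∈B) → resp A u≈v u∈A , resp B u≈v u∈B
  }

fromList : List (Vector c d) → Subset c d
fromList {c} {d} us = record
  { member = λ u → SetoidMembership._∈_ (vectorSetoid c d) u us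
  ; resp   = λ {u} {v} → ∈-resp-≈ (vectorSetoid c d) {us} {u} {v}
  }
  where open import Data.List.Membership.Setoid.Properties using (∈-resp-≈)

Finite : Subset c d → Set
Finite A = ∃[ us ] A ≐ fromList us

-- ℤ^(I_n), identified with its image in ℤ^(I) under extension by zero.
ℤ^I[_] : ℕ → Subset c d
ℤ^I[ n ] = record
  { member = λ u → ∀ x → coeff u x ≢ 0ℤ → Below n x
  ; resp   = λ u≈v u∈ x vx≢0 → u∈ x (vx≢0 ∘ trans (sym (u≈v x)))
  }

ℤ≥0^I : Subset c d
ℤ≥0^I = record
  { member = λ u → ∀ x → 0ℤ ≤ᶻ coeff u x
  ; resp   = λ u≈v u≥0 x → subst (0ℤ ≤ᶻ_) (u≈v x) (u≥0 x)
  }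

linearCombination : List (ℕ × Vector c d) → Vector c d
linearCombination = foldr (λ (k , a) v → k ⊙ a ⊕ v) 𝟎

ℤ≥0⟨_⟩ : Subset c d → Subset c d
ℤ≥0⟨ A ⟩ = record
  { member = λ u → ∃[ ts ] All (λ (_ , a) → a ∈ A) ts × u ≈ linearCombination ts
  ; resp   = λ u≈v (ts , ts∈A , u≈) → ts , ts∈A , λ x → trans (sym (u≈v x)) (u≈ x)
  }

record IsMonoid (M : Subset c d) : Set where
  field
    𝟎-mem    : 𝟎 ∈ M
    ⊕-closed : ∀ {u v} → u ∈ M → v ∈ M → u ⊕ v ∈ M

Generates : Subset c d → Subset c d → Set
Generates A M = M ≐ ℤ≥0⟨ A ⟩

FinitelyGenerated : Subset c d → Set₁
FinitelyGenerated M = ∃[ A ] Finite A × Generates A M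

record IsHilbertBasis (A M : Subset c d) : Set₁ where
  field
    generates : Generates A M
    minimal   : ∀ B → B ⊆ A → Generates B M → A ⊆ B

-- Sym(n) as the permutations of the position set ℕ that fix everything outside
-- [n]; with this reading the embeddings Sym(n) ⊆ Sym(n+1) are inclusions.
Sym[_] : ℕ → Pred (ℕ ↔ ℕ) 0ℓ
Sym[ n ] σ = ∀ i → n ≤ i → Inverse.to σ i ≡ i

Sym : Pred (ℕ ↔ ℕ) 0ℓ
Sym σ = ∃[ n ] 1 ≤ n × Sym[ n ] σ

permute : ∀ {c d} → (ℕ → ℕ) → Index c d → Index c d
permute f (is , j) = Vec.map f is , j

permute-inverse : ∀ {f g : ℕ → ℕ} → (∀ i → f (g i) ≡ i) →
                  (x : Index c d) → permute f (permute g x) ≡ x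
permute-inverse {f = f} {g} fg (is , j) = cong (_, j)
  (trans (sym (Vec.map-∘ f g is)) (trans (Vec.map-cong fg is) (Vec.map-id is)))

-- The linear extension of 𝐞 x ↦ 𝐞 (σ x): the coefficient of σ(u) at x is that
-- of u at σ⁻¹ x.
act : (ℕ ↔ ℕ) → Vector c d → Vector c d
act σ u = record
  { coeff    = coeff u ∘ permute from
  ; bound    = map (permute to) (bound u)
  ; vanishes = λ x x∉ → vanishes u (permute from x) λ p →
      x∉ (subst (_∈ˡ map (permute to) (bound u))
            (permute-inverse strictlyInverseˡ x) (∈-map⁺ (permute to) p))
  }
  where open Inverse σ

act-𝐞 : ∀ (σ : ℕ ↔ ℕ) (y : Index c d) → act σ (𝐞 y) ≈ 𝐞 (permute (Inverse.to σ) y)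
act-𝐞 σ y x with permute (Inverse.from σ) x ≟ᴵ y | x ≟ᴵ permute (Inverse.to σ) y
... | yes _    | yes _    = refl
... | no  _    | no  _    = refl
... | yes refl | no  x≢   = contradiction (sym (permute-inverse (Inverse.strictlyInverseˡ σ) x)) x≢
... | no  ≢y   | yes refl = contradiction (permute-inverse (Inverse.strictlyInverseʳ σ) y) ≢y

act-⊕ : ∀ (σ : ℕ ↔ ℕ) (u v : Vector c d) → act σ (u ⊕ v) ≈ act σ u ⊕ act σ v
act-⊕ σ u v x = refl

-- G(A)
_⟪_⟫ : Pred (ℕ ↔ ℕ) 0ℓ → Subset c d → Subset c d
G ⟪ A ⟫ = record
  { member = λ v → ∃[ σ ] ∃[ u ] G σ × u ∈ A × v ≈ act σ u
  ; resp   = λ v≈w (σ , u , σ∈G , u∈A , v≈) →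
      σ , u , σ∈G , u∈A , λ x → trans (sym (v≈w x)) (v≈ x)
  }

record IsEquivariantHilbertBasis (G : Pred (ℕ ↔ ℕ) 0ℓ) (H M : Subset c d) : Set₁ where
  field
    included     : H ⊆ M
    hilbertBasis : IsHilbertBasis (G ⟪ H ⟫) M

-- A sequence (Mₙ)_{n ≥ 1} is a function on ℕ whose value at 0 is never used.
record IsSymInvariantChain (M : ℕ → Subset c d) : Set where
  field
    bounded   : ∀ n → 1 ≤ n → M n ⊆ ℤ^I[ n ]
    isMonoid  : ∀ n → 1 ≤ n → IsMonoid (M n)
    monotone  : ∀ m n → 1 ≤ m → m ≤ n → M m ⊆ M n
    invariant : ∀ n → 1 ≤ n → Sym[ n ] ⟪ M n ⟫ ⊆ M n

⋃ : (ℕ → Subset c d) → Subset c d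
⋃ M = record
  { member = λ u → ∃[ n ] 1 ≤ n × u ∈ M n
  ; resp   = λ u≈v (n , 1≤n , u∈) → n , 1≤n , resp (M n) u≈v u∈
  }

Stabilizes : (ℕ → Subset c d) → Set
Stabilizes M = ∃[ p ] 1 ≤ p × (∀ m n → p ≤ m → m ≤ n → M n ≐ ℤ≥0⟨ Sym[ n ] ⟪ M m ⟫ ⟩)

EventuallyFinitelyGenerated : (ℕ → Subset c d) → Set₁
EventuallyFinitelyGenerated M = ∃[ N ] 1 ≤ N × (∀ n → N ≤ n → FinitelyGenerated (M n))

StableEquivariantHilbertBasis : (ℕ → Subset c d) → Set₁
StableEquivariantHilbertBasis M =
  ∃[ p ] 1 ≤ p × (∃[ H ] Finite H
    × IsEquivariantHilbertBasis Sym[ p ] H (M p)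
    × (∀ n → p ≤ n → IsEquivariantHilbertBasis Sym[ n ] H (M n)))

SaturatedWithBoundedSupport : (ℕ → Subset c d) → Set₁
SaturatedWithBoundedSupport M =
  ∃[ q ] ∃[ q′ ] 1 ≤ q × 1 ≤ q′ × (∀ n → q ≤ n →
    (M n ≐ ⋃ M ∩ ℤ^I[ n ])
    × (∃[ A ] Finite A × IsHilbertBasis A (M n) × (∀ u → u ∈ A → supportSize u ≤ q′)))

FiniteEquivariantHilbertBasis : Subset c d → Set₁
FiniteEquivariantHilbertBasis M = ∃[ H ] Finite H × IsEquivariantHilbertBasis Sym H M

{-# OPTIONS --safe #-}
module Submission where

-- In a monoid M of nonnegative vectors a generating set is a Hilbert basis iff all its
-- elements are irreducible in M, so Hilbert bases are unique and invariant under the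
-- symmetries of M.  A sum of nonnegative vectors is supported in I_n only if every summand
-- is, and a permutation moving a vector of ℤ^(I_n) into ℤ^(I_n) may be replaced by one in
-- Sym(n).  Hence, once the chain is generated by the orbits of some H ⊆ M_p, one has
-- M_n = M ∩ ℤ^(I_n) for n ≥ p, and irreducibility in M_n and in M coincide on M_n; the four
-- conditions then all say that finitely many irreducibles of M have orbits generating every
-- M_n with n ≥ p.  Bounded support gives this because a vector with at most q′ nonzero
-- entries involves at most q′·d positions and so has a translate in ℤ^(I_p) for p = max(q, q′·d).
-- Constructively, a finite Hilbert basis is extracted from a finite generating set by
-- discarding redundant generators, which is decidable for nonnegative vectors.

open import Data.Nat using (ℕ; zero; suc; _+_; _*_; _≤_; _<_; _⊔_; z≤n; s≤s; s≤s⁻¹; _≤?_; _<?_)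
import Data.Nat.Properties as ℕ
open import Data.Integer using (+_; 0ℤ; ∣_∣) renaming (_+_ to _+ᶻ_; _*_ to _*ᶻ_; _-_ to _-ᶻ_; _≤_ to _≤ᶻ_)
import Data.Integer.Properties as ℤ
open import Algebra.Properties.AbelianGroup ℤ.+-0-abelianGroup using (∙-cancelˡ)
open import Data.Integer.Tactic.RingSolver using (solve-∀)
open import Data.Vec using (Vec; []; _∷_; toList)
import Data.Vec as Vec
import Data.Vec.Properties as Vec
import Data.Vec.Relation.Unary.All as Allᵛ
open import Data.List using (List; []; _∷_; _++_; length; filter; concatMap; upTo; cartesianProductWith)
open import Data.List.Properties using (filter-notAll; length-map; length-++)
open import Data.List.Relation.Unary.All as All using (All; []; _∷_; all?)
open import Data.List.Relation.Unary.All.Properties using (¬All⇒Any¬; filter⁺)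
open import Data.List.Relation.Unary.Any as Any using (here; there; any?)
open import Data.List.Relation.Unary.AllPairs using ([]; _∷_)
open import Data.List.Relation.Unary.Unique.Propositional using (Unique)
open import Data.List.Relation.Unary.Unique.DecPropositional.Properties using (deduplicate-!)
import Data.List.Membership.DecPropositional as DecMembership
open import Data.List.Membership.Propositional using (find; lose) renaming (_∈_ to _∈ˡ_)
open import Data.List.Membership.Propositional.Properties
  using (∈-++⁺ˡ; ∈-++⁺ʳ; ∈-filter⁺; ∈-filter⁻; ∈-deduplicate⁺; ∈-deduplicate⁻;
         ∈-concatMap⁺; ∈-concatMap⁻; ∈-upTo⁺; ∈-upTo⁻; ∈-cartesianProductWith⁺; ∈-cartesianProductWith⁻)
open import Data.Product using (∃-syntax; _×_; _,_; proj₁; proj₂)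
open import Data.Sum using (_⊎_; inj₁; inj₂; [_,_]′)
open import Function using (_∘_; id; _↔_; Inverse; mk↔ₛ′)
open import Function.Bundles using (_⇔_; mk⇔)
open import Function.Construct.Identity using (↔-id)
open import Function.Construct.Composition using (_↔-∘_; _⇔-∘_)
open import Function.Construct.Symmetry using (↔-sym; ⇔-sym)
open import Level using (0ℓ)
open import Relation.Binary.PropositionalEquality
  using (_≡_; _≢_; refl; sym; trans; cong; cong₂; subst)
open import Relation.Nullary using (Dec; yes; no; ¬_; ¬?; contradiction)
open import Relation.Nullary.Decidable using (map′)
open import Relation.Unary using (Pred)
open import Defs

infixl 6 _⊖_
infixl 7 _∖_

private
  variable
    c d : ℕ
    A B M : Subset c d

-- Vectors

_∈?_ : (x : Index c d) (xs : List (Index c d)) → Dec (x ∈ˡ xs)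
_∈?_ = DecMembership._∈?_ _≟ᴵ_

private
  -- Outside both bounds the two vectors vanish, so equality on the infinite index set reduces to a
  -- finite check. This is what makes `_≈_` decidable.
  agreeOnBounds⇒≈ : (u v : Vector c d) →
                    All (λ x → coeff u x ≡ coeff v x) (bound u ++ bound v) → u ≈ v
  agreeOnBounds⇒≈ u v agree x with x ∈? (bound u ++ bound v)
  ... | yes x∈ = All.lookup agree x∈
  ... | no  x∉ = trans (vanishes u x (x∉ ∘ ∈-++⁺ˡ)) (sym (vanishes v x (x∉ ∘ ∈-++⁺ʳ (bound u))))

_≈?_ : (u v : Vector c d) → Dec (u ≈ v)
u ≈? v = map′ (agreeOnBounds⇒≈ u v) (λ u≈v → All.universal u≈v _)
              (all? (λ x → coeff u x ℤ.≟ coeff v x) (bound u ++ bound v))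

≉⇒∃ : (u v : Vector c d) → ¬ u ≈ v → ∃[ x ] coeff u x ≢ coeff v x
≉⇒∃ u v u≉v = Any.satisfied
  (¬All⇒Any¬ (λ x → coeff u x ℤ.≟ coeff v x) _ (u≉v ∘ agreeOnBounds⇒≈ u v))

_⊖_ : Vector c d → Vector c d → Vector c d
u ⊖ v = record
  { coeff    = λ x → coeff u x -ᶻ coeff v x
  ; bound    = bound u ++ bound v
  ; vanishes = λ x x∉ → cong₂ _-ᶻ_
      (vanishes u x (x∉ ∘ ∈-++⁺ˡ)) (vanishes v x (x∉ ∘ ∈-++⁺ʳ (bound u)))
  }

i+j≡0⇒i≡0 : ∀ {i j} → 0ℤ ≤ᶻ i → 0ℤ ≤ᶻ j → i +ᶻ j ≡ 0ℤ → i ≡ 0ℤ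
i+j≡0⇒i≡0 {+ m} {+ n} _ _ eq = cong +_ (ℕ.m+n≡0⇒m≡0 m (ℤ.+-injective eq))

i+j≡0⇒j≡0 : ∀ {i j} → 0ℤ ≤ᶻ i → 0ℤ ≤ᶻ j → i +ᶻ j ≡ 0ℤ → j ≡ 0ℤ
i+j≡0⇒j≡0 {i} {j} i≥0 j≥0 eq = i+j≡0⇒i≡0 j≥0 i≥0 (trans (ℤ.+-comm j i) eq)

⊕-nonneg : (u v : Vector c d) → u ∈ ℤ≥0^I → v ∈ ℤ≥0^I → u ⊕ v ∈ ℤ≥0^I
⊕-nonneg u v u≥0 v≥0 x = ℤ.+-mono-≤ (u≥0 x) (v≥0 x)

module _ (u v a : Vector c d) (u≥0 : u ∈ ℤ≥0^I) (v≥0 : v ∈ ℤ≥0^I) (a≈u⊕v : a ≈ u ⊕ v) where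

  -- Nonnegative coefficients cannot cancel: wherever `a` vanishes, so do both summands.
  summandˡ-bounded : ∀ {n} → a ∈ ℤ^I[ n ] → u ∈ ℤ^I[ n ]
  summandˡ-bounded a∈ x ux≢0 =
    a∈ x λ ax≡0 → ux≢0 (i+j≡0⇒i≡0 (u≥0 x) (v≥0 x) (trans (sym (a≈u⊕v x)) ax≡0))

  summandʳ-bounded : ∀ {n} → a ∈ ℤ^I[ n ] → v ∈ ℤ^I[ n ]
  summandʳ-bounded a∈ x vx≢0 =
    a∈ x λ ax≡0 → vx≢0 (i+j≡0⇒j≡0 (u≥0 x) (v≥0 x) (trans (sym (a≈u⊕v x)) ax≡0))

-- Generated submonoids

-- Inductive form of `ℤ≥0⟨ A ⟩`: multiplicities are unfolded into single summands, so that arguments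
-- can peel off one generator at a time.
data Span (A : Subset c d) : Vector c d → Set where
  nil  : ∀ {u} → u ≈ 𝟎 → Span A u
  cons : ∀ {u} a v → a ∈ A → Span A v → u ≈ a ⊕ v → Span A u

Span-resp : ∀ {u v} → u ≈ v → Span A u → Span A v
Span-resp u≈v (nil u≈0)            = nil λ x → trans (sym (u≈v x)) (u≈0 x)
Span-resp u≈v (cons a w a∈ s u≈)   = cons a w a∈ s λ x → trans (sym (u≈v x)) (u≈ x)

Span-⊕ : ∀ {u v} → Span A u → Span A v → Span A (u ⊕ v)
Span-⊕ {v = v} (nil u≈0) t = Span-resp {u = v}
  (λ x → sym (trans (cong (_+ᶻ coeff v x) (u≈0 x)) (ℤ.+-identityˡ _))) t
Span-⊕ {v = v} (cons a w a∈ s u≈) t = cons a (w ⊕ v) a∈ (Span-⊕ s t)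
  λ x → trans (cong (_+ᶻ coeff v x) (u≈ x)) (ℤ.+-assoc (coeff a x) _ _)

Span-multiple : ∀ {v} k a → a ∈ A → Span A v → Span A (k ⊙ a ⊕ v)
Span-multiple {v = v} zero a a∈ s = Span-resp {u = v}
  (λ x → sym (trans (cong (_+ᶻ coeff v x) (ℤ.*-zeroˡ (coeff a x))) (ℤ.+-identityˡ _))) s
Span-multiple {v = v} (suc k) a a∈ s = cons a (k ⊙ a ⊕ v) a∈ (Span-multiple k a a∈ s)
  λ x → trans (cong (_+ᶻ coeff v x) (ℤ.suc-* (+ k) (coeff a x))) (ℤ.+-assoc (coeff a x) _ _)

⟨⟩⇒Span : ∀ {u} → u ∈ ℤ≥0⟨ A ⟩ → Span A u
⟨⟩⇒Span {A = A} (ts , ts∈A , u≈) = Span-resp {u = linearCombination ts} (λ x → sym (u≈ x)) (go ts ts∈A)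
  where
  go : ∀ ts → All (λ (_ , a) → a ∈ A) ts → Span A (linearCombination ts)
  go []             []          = nil λ _ → refl
  go ((k , a) ∷ ts) (a∈ ∷ ts∈A) = Span-multiple k a a∈ (go ts ts∈A)

Span⇒⟨⟩ : ∀ {u} → Span A u → u ∈ ℤ≥0⟨ A ⟩
Span⇒⟨⟩ (nil u≈0) = [] , [] , u≈0
Span⇒⟨⟩ (cons a v a∈ s u≈) with ts , ts∈A , v≈ ← Span⇒⟨⟩ s =
  (1 , a) ∷ ts , a∈ ∷ ts∈A ,
  λ x → trans (u≈ x) (cong₂ _+ᶻ_ (sym (ℤ.*-identityˡ (coeff a x))) (v≈ x))

∈⇒Span : ∀ {a} → a ∈ A → Span A a
∈⇒Span {a = a} a∈ = cons a 𝟎 a∈ (nil λ _ → refl) λ x → sym (ℤ.+-identityʳ _)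

Span-bind : (∀ a → a ∈ A → Span B a) → ∀ {u} → Span A u → Span B u
Span-bind f (nil u≈0)          = nil u≈0
Span-bind f (cons a v a∈ s u≈) =
  Span-resp {u = a ⊕ v} (λ x → sym (u≈ x)) (Span-⊕ (f a a∈) (Span-bind f s))

Span-⊆ : IsMonoid M → (∀ a → a ∈ A → a ∈ M) → ∀ {u} → Span A u → u ∈ M
Span-⊆ {M = M} mon A⊆M (nil u≈0) = resp M (λ x → sym (u≈0 x)) (IsMonoid.𝟎-mem mon)
Span-⊆ {M = M} mon A⊆M (cons a v a∈ s u≈) =
  resp M (λ x → sym (u≈ x)) (IsMonoid.⊕-closed mon (A⊆M a a∈) (Span-⊆ mon A⊆M s))

-- Irreducible elements

-- These are the atoms of `M`: in a monoid of nonnegative vectors, `𝟎` is the only unit.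
record Irreducible (M : Subset c d) (a : Vector c d) : Set where
  field
    nonzero : ¬ a ≈ 𝟎
    split   : ∀ u v → u ∈ M → v ∈ M → a ≈ u ⊕ v → u ≈ 𝟎 ⊎ v ≈ 𝟎

open Irreducible

Irreducible-⊆ : ∀ {M N : Subset c d} {a} → (∀ u → u ∈ N → u ∈ M) → Irreducible M a → Irreducible N a
Irreducible-⊆ N⊆M irr = record
  { nonzero = nonzero irr
  ; split   = λ u v u∈ v∈ → split irr u v (N⊆M u u∈) (N⊆M v v∈)
  }

module _ {M : Subset c d} (mon : IsMonoid M) where

  -- At each summand of an expression of `a`, irreducibility makes either the summand or the
  -- remainder vanish. In the first case the search continues, in the second the summand is `a`.
  irreducible-generator : ∀ {B : Subset c d} → (∀ b → b ∈ B → b ∈ M) →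
                          ∀ a → Irreducible M a → Span B a → a ∈ B
  irreducible-generator {B} B⊆M a irr s = go s (λ _ → refl)
    where
    go : ∀ {w} → Span B w → a ≈ w → a ∈ B
    go (nil w≈0) a≈w = contradiction (λ x → trans (a≈w x) (w≈0 x)) (nonzero irr)
    go {w} (cons b v b∈ s w≈) a≈w
      with split irr b v (B⊆M b b∈) (Span-⊆ {M = M} mon B⊆M s) (λ x → trans (a≈w x) (w≈ x))
    ... | inj₁ b≈0 = go s λ x → trans (a≈w x) (trans (w≈ x)
                       (trans (cong (_+ᶻ coeff v x) (b≈0 x)) (ℤ.+-identityˡ _)))
    ... | inj₂ v≈0 = resp B (λ x → sym (trans (a≈w x) (trans (w≈ x)
                       (trans (cong (coeff b x +ᶻ_) (v≈0 x)) (ℤ.+-identityʳ _))))) b∈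

  irreducible⇒hilbertBasis : ∀ {A : Subset c d} → Generates A M →
                             (∀ a → a ∈ A → Irreducible M a) → IsHilbertBasis A M
  irreducible⇒hilbertBasis {A} gen irr = record
    { generates = gen
    ; minimal   = λ B B⊆A genB {a} a∈A → irreducible-generator {B}
        (λ b b∈ → proj₂ genB {b} (Span⇒⟨⟩ (∈⇒Span {A = B} b∈))) a (irr a a∈A)
        (⟨⟩⇒Span (proj₁ genB {a} (proj₂ gen {a} (Span⇒⟨⟩ (∈⇒Span {A = A} a∈A)))))
    }

_∖_ : Subset c d → Vector c d → Subset c d
A ∖ a = record
  { member = λ u → u ∈ A × ¬ u ≈ a
  ; resp   = λ u≈v (u∈A , u≉a) → resp A u≈v u∈A , λ v≈a → u≉a λ x → trans (u≈v x) (v≈a x)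
  }

-- Every summand equal to `a` is replaced by the given expression of `a` in the other elements.
Span-∖ : ∀ {A : Subset c d} {a} → Span (A ∖ a) a → ∀ {u} → Span A u → Span (A ∖ a) u
Span-∖ {A = A} {a} sa = Span-bind λ b b∈A → lemma b b∈A
  where
  lemma : ∀ b → b ∈ A → Span (A ∖ a) b
  lemma b b∈A with b ≈? a
  ... | yes b≈a = Span-resp (λ x → sym (b≈a x)) sa
  ... | no  b≉a = ∈⇒Span (b∈A , b≉a)

module _ {M A : Subset c d} (M≥0 : ∀ u → u ∈ M → u ∈ ℤ≥0^I) (hb : IsHilbertBasis A M) where
  open IsHilbertBasis hb

  private
    A⊆M : ∀ a → a ∈ A → a ∈ M
    A⊆M a a∈ = proj₂ generates {a} (Span⇒⟨⟩ (∈⇒Span {A = A} a∈))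

    spans : ∀ u → u ∈ M → Span A u
    spans u u∈ = ⟨⟩⇒Span (proj₁ generates {u} u∈)

  -- Otherwise `A` without `a` would still generate `M`, and minimality would place `a` in it.
  hilbertBasis-irredundant : ∀ a → a ∈ A → ¬ Span (A ∖ a) a
  hilbertBasis-irredundant a a∈A sa = proj₂ (minimal (A ∖ a) proj₁ gen {a} a∈A) λ _ → refl
    where
    gen : Generates (A ∖ a) M
    gen = (λ {u} u∈ → Span⇒⟨⟩ (Span-∖ {A = A} sa (spans u u∈)))
        , (λ {u} u∈ → proj₂ generates {u}
             (Span⇒⟨⟩ (Span-bind {B = A} (λ b (b∈A , _) → ∈⇒Span b∈A) (⟨⟩⇒Span {A = A ∖ a} {u} u∈))))

  -- If a itself occurred in the proper summand w of a, the complement z would vanish.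
  properSummand-avoids : ∀ a {w} z → Span A w → a ≈ w ⊕ z → z ∈ ℤ≥0^I → ¬ z ≈ 𝟎 → Span (A ∖ a) w
  properSummand-avoids a z (nil w≈0) a≈ z≥0 z≉0 = nil w≈0
  properSummand-avoids a {w} z (cons b v b∈ s w≈) a≈ z≥0 z≉0 with b ≈? a
  ... | yes b≈a = contradiction z≈0 z≉0
    where
    v≥0 : v ∈ ℤ≥0^I
    v≥0 = M≥0 v (proj₂ generates {v} (Span⇒⟨⟩ s))
    z≈0 : z ≈ 𝟎
    z≈0 x = i+j≡0⇒j≡0 (v≥0 x) (z≥0 x) (∙-cancelˡ (coeff b x) _ _
      (trans (sym (ℤ.+-assoc (coeff b x) _ _)) (trans (cong (_+ᶻ coeff z x) (sym (w≈ x)))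
        (trans (sym (a≈ x)) (trans (sym (b≈a x)) (sym (ℤ.+-identityʳ _)))))))
  -- The summand `b` is moved into the complement, which stays nonzero because nothing cancels, and
  -- the induction continues with `v`.
  ... | no b≉a = cons b v (b∈ , b≉a)
    (properSummand-avoids a (b ⊕ z) s a≈v⊕[b⊕z] (⊕-nonneg b z b≥0 z≥0)
      λ eq → z≉0 λ x → i+j≡0⇒j≡0 (b≥0 x) (z≥0 x) (eq x)) w≈
    where
    b≥0 : b ∈ ℤ≥0^I
    b≥0 = M≥0 b (A⊆M b b∈)
    a≈v⊕[b⊕z] : a ≈ v ⊕ (b ⊕ z)
    a≈v⊕[b⊕z] x = trans (a≈ x) (trans (cong (_+ᶻ coeff z x)
      (trans (w≈ x) (ℤ.+-comm (coeff b x) _))) (ℤ.+-assoc (coeff v x) _ _))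

  -- If both parts of a splitting of `a` were nonzero, each would have an expression avoiding `a`;
  -- their sum would make `a` redundant.
  hilbertBasis-irreducible : ∀ a → a ∈ A → Irreducible M a
  hilbertBasis-irreducible a a∈A = record
    { nonzero = λ a≈0 → hilbertBasis-irredundant a a∈A (nil a≈0)
    ; split   = splits
    }
    where
    splits : ∀ u v → u ∈ M → v ∈ M → a ≈ u ⊕ v → u ≈ 𝟎 ⊎ v ≈ 𝟎
    splits u v u∈ v∈ a≈ with u ≈? 𝟎 | v ≈? 𝟎
    ... | yes u≈0 | _       = inj₁ u≈0
    ... | no _    | yes v≈0 = inj₂ v≈0
    ... | no u≉0  | no v≉0  = contradiction
      (Span-resp {u = u ⊕ v} (λ x → sym (a≈ x)) (Span-⊕
        (properSummand-avoids a v (spans u u∈) a≈ (M≥0 v v∈) v≉0)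
        (properSummand-avoids a u (spans v v∈) (λ x → trans (a≈ x) (ℤ.+-comm (coeff u x) _))
          (M≥0 u u∈) u≉0)))
      (hilbertBasis-irredundant a a∈A)

-- Finite generating sets contain Hilbert bases

multiple-bound : ∀ k {i j} → 0ℤ ≤ᶻ i → i ≢ 0ℤ → 0ℤ ≤ᶻ j → k ≤ ∣ + k *ᶻ i +ᶻ j ∣
multiple-bound k {+ zero}  {+ l} _ i≢0 _ = contradiction refl i≢0
multiple-bound k {+ suc m} {+ l} _ i≢0 _ rewrite sym (ℤ.pos-* k (suc m)) =
  ℕ.≤-trans (ℕ.m≤m*n k (suc m)) (ℕ.m≤m+n _ l)

Span-nonneg : ∀ {A : Subset c d} → (∀ a → a ∈ A → a ∈ ℤ≥0^I) → ∀ {u} → Span A u → u ∈ ℤ≥0^I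
Span-nonneg = Span-⊆ {M = ℤ≥0^I} record
  { 𝟎-mem    = λ _ → ℤ.≤-refl
  ; ⊕-closed = λ {u} {v} → ⊕-nonneg u v
  }

fromList-nonneg : ∀ {us : List (Vector c d)} → All (_∈ ℤ≥0^I) us → ∀ a → a ∈ fromList us → a ∈ ℤ≥0^I
fromList-nonneg us≥0 a a∈ with b , b∈ , a≈b ← find a∈ =
  resp ℤ≥0^I {b} {a} (λ x → sym (a≈b x)) (All.lookup us≥0 b∈)

-- Collecting all copies of `b` into one multiple leaves only the number `k` to search for in
-- `Span?`.
Span-∷ : ∀ {b : Vector c d} {bs u} → Span (fromList (b ∷ bs)) u →
         ∃[ k ] ∃[ w ] Span (fromList bs) w × u ≈ k ⊙ b ⊕ w
Span-∷ {b = b} (nil u≈0) = 0 , 𝟎 , nil (λ _ → refl) , λ x → trans (u≈0 x)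
  (sym (trans (ℤ.+-identityʳ _) (ℤ.*-zeroˡ (coeff b x))))
Span-∷ {b = b} (cons a v (here a≈b) s u≈) with k , w , sw , v≈ ← Span-∷ s =
  suc k , w , sw , λ x → trans (u≈ x) (trans (cong₂ _+ᶻ_ (a≈b x) (v≈ x))
    (trans (sym (ℤ.+-assoc (coeff b x) _ _))
           (cong (_+ᶻ coeff w x) (sym (ℤ.suc-* (+ k) (coeff b x))))))
Span-∷ {b = b} (cons a v (there a∈) s u≈) with k , w , sw , v≈ ← Span-∷ s =
  k , a ⊕ w , cons a w a∈ sw (λ _ → refl) , λ x → trans (u≈ x)
    (trans (cong (coeff a x +ᶻ_) (v≈ x)) (swap (coeff a x) (+ k *ᶻ coeff b x) (coeff w x)))
  where
  swap : ∀ i j k → i +ᶻ (j +ᶻ k) ≡ j +ᶻ (i +ᶻ k)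
  swap = solve-∀

-- Recursion on the generators. A nonzero `b` is positive at some `x₀`, where `k` copies contribute
-- at least `k`; hence only `k ≤ ∣ coeff u x₀ ∣` can occur and the search is finite.
Span? : ∀ (bs : List (Vector c d)) → All (_∈ ℤ≥0^I) bs → ∀ u → Dec (Span (fromList bs) u)
Span? [] [] u = map′ nil (λ { (nil u≈0) → u≈0 }) (u ≈? 𝟎)
Span? (b ∷ bs) (b≥0 ∷ bs≥0) u with b ≈? 𝟎
... | yes b≈0 = map′
  (Span-bind λ a a∈ → ∈⇒Span (there a∈))
  (Span-bind λ { a (here a≈b) → nil λ x → trans (a≈b x) (b≈0 x) ; a (there a∈) → ∈⇒Span a∈ })
  (Span? bs bs≥0 u)
... | no b≉0 with x₀ , bx₀≢0 ← ≉⇒∃ b 𝟎 b≉0 = map′ to from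
  (ℕ.anyUpTo? (λ k → Span? bs bs≥0 (u ⊖ k ⊙ b)) (suc ∣ coeff u x₀ ∣))
  where
  restore : ∀ i j → j +ᶻ (i -ᶻ j) ≡ i
  restore = solve-∀
  remove : ∀ j k → k ≡ (j +ᶻ k) -ᶻ j
  remove = solve-∀

  to : ∃[ k ] k < suc ∣ coeff u x₀ ∣ × Span (fromList bs) (u ⊖ k ⊙ b) → Span (fromList (b ∷ bs)) u
  to (k , _ , s) = Span-resp {u = k ⊙ b ⊕ (u ⊖ k ⊙ b)}
    (λ x → restore (coeff u x) (+ k *ᶻ coeff b x))
    (Span-multiple k b (here λ _ → refl) (Span-bind (λ a a∈ → ∈⇒Span (there a∈)) s))

  from : Span (fromList (b ∷ bs)) u → ∃[ k ] k < suc ∣ coeff u x₀ ∣ × Span (fromList bs) (u ⊖ k ⊙ b)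
  from s with k , w , sw , u≈ ← Span-∷ s = k
    , s≤s (subst (λ i → k ≤ ∣ i ∣) (sym (u≈ x₀)) (multiple-bound k (b≥0 x₀) bx₀≢0
        (Span-nonneg (fromList-nonneg bs≥0) sw x₀)))
    , Span-resp {u = w} (λ x → trans (remove (+ k *ᶻ coeff b x) (coeff w x))
        (cong (_-ᶻ (+ k *ᶻ coeff b x)) (sym (u≈ x)))) sw

delete : Vector c d → List (Vector c d) → List (Vector c d)
delete a = filter (λ b → ¬? (b ≈? a))

∈-delete⁺ : ∀ {a b : Vector c d} {as} → b ∈ fromList as ∖ a → b ∈ fromList (delete a as)
∈-delete⁺ (b∈ , b≉a) with b′ , b′∈ , b≈b′ ← find b∈ =
  lose (∈-filter⁺ _ b′∈ λ b′≈a → b≉a λ x → trans (b≈b′ x) (b′≈a x)) b≈b′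

∈-delete⁻ : ∀ {a b : Vector c d} {as} → b ∈ fromList (delete a as) → b ∈ fromList as
∈-delete⁻ {as = as} b∈ with b′ , b′∈ , b≈b′ ← find b∈ = lose (proj₁ (∈-filter⁻ _ {xs = as} b′∈)) b≈b′

delete-shorter : ∀ {a : Vector c d} {as} → a ∈ˡ as → length (delete a as) < length as
delete-shorter {a = a} {as} a∈ =
  filter-notAll (λ b → ¬? (b ≈? a)) as (lose a∈ λ a≉a → a≉a λ _ → refl)

Redundant : List (Vector c d) → Vector c d → Set
Redundant as a = Span (fromList (delete a as)) a

-- Redundant generators are deleted until none is left. The number `k` bounds the length of the list
-- and drives the recursion, since each deletion shortens the list.
irredundantSublist : ∀ k (as : List (Vector c d)) → length as ≤ k → All (_∈ ℤ≥0^I) as →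
  ∃[ bs ] (∀ {u} → Span (fromList as) u → Span (fromList bs) u)
        × (∀ b → b ∈ fromList bs → b ∈ fromList as)
        × (∀ b → b ∈ˡ bs → ¬ Redundant bs b)
irredundantSublist k as len as≥0
  with any? (λ a → Span? (delete a as) (filter⁺ _ as≥0) a) as
... | no none = as , id , (λ _ → id) , λ b b∈ red → none (lose b∈ red)
... | yes some with a , a∈ , red ← find some with k
...   | zero  = contradiction (ℕ.<-≤-trans (delete-shorter a∈) len) ℕ.n≮0
...   | suc k
  with bs , spans , bs⊆ , irr ← irredundantSublist k (delete a as)
         (s≤s⁻¹ (ℕ.<-≤-trans (delete-shorter a∈) len)) (filter⁺ _ as≥0)
  = bs , spans ∘ Span-bind step , (λ b b∈ → ∈-delete⁻ {a = a} {b} {as} (bs⊆ b b∈)) , irr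
  where
  step : ∀ b → b ∈ fromList as → Span (fromList (delete a as)) b
  step b b∈ with b ≈? a
  ... | yes b≈a = Span-resp {u = a} (λ x → sym (b≈a x)) red
  ... | no  b≉a = ∈⇒Span (∈-delete⁺ {a = a} {b} {as} (b∈ , b≉a))

-- Membership in `B` need not be decidable, but an expression has finitely many summands and each
-- can be compared with `a`.
Span-split : ∀ {B : Subset c d} a {u} → Span B u → a ∈ B ⊎ Span (B ∖ a) u
Span-split a (nil u≈0) = inj₂ (nil u≈0)
Span-split {B = B} a (cons b v b∈ s u≈) with b ≈? a | Span-split a s
... | yes b≈a | _       = inj₁ (resp B b≈a b∈)
... | no _    | inj₁ a∈ = inj₁ a∈
... | no b≉a  | inj₂ s′ = inj₂ (cons b v (b∈ , b≉a) s′ u≈)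

finitelyGenerated⇒finiteHilbertBasis : ∀ {M : Subset c d} → (∀ u → u ∈ M → u ∈ ℤ≥0^I) →
  FinitelyGenerated M → ∃[ H ] Finite H × IsHilbertBasis H M
finitelyGenerated⇒finiteHilbertBasis {M = M} M≥0 (A , (as , A⊆as , as⊆A) , M⊆⟨A⟩ , ⟨A⟩⊆M)
  with bs , spans , bs⊆as , irredundant ← irredundantSublist (length as) as ℕ.≤-refl
         (All.tabulate λ {a} a∈ → M≥0 a (⟨A⟩⊆M {a} (Span⇒⟨⟩ (∈⇒Span {A = A} (as⊆A {a} (lose a∈ λ _ → refl))))))
  = H , (bs , id , id) , record { generates = gen ; minimal = minimal }
  where
  H = fromList bs

  gen : Generates H M
  gen = (λ {u} u∈ → Span⇒⟨⟩ {A = H} (spans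
          (Span-bind (λ a a∈ → ∈⇒Span {A = fromList as} {a} (A⊆as {a} a∈)) (⟨⟩⇒Span {A = A} {u} (M⊆⟨A⟩ {u} u∈)))))
      , (λ {u} u∈ → ⟨A⟩⊆M {u} (Span⇒⟨⟩
          (Span-bind (λ b b∈ → ∈⇒Span {A = A} (as⊆A {b} (bs⊆as b b∈))) (⟨⟩⇒Span {A = H} {u} u∈))))

  minimal : ∀ B → B ⊆ H → Generates B M → H ⊆ B
  -- An expression of `b` over `B` either uses `b`, so that `b` lies in `B`, or avoids it, which
  -- would make `b` redundant in `bs`.
  minimal B B⊆H (M⊆⟨B⟩ , _) {a} a∈H with b , b∈bs , a≈b ← find a∈H
    with Span-split b (⟨⟩⇒Span {A = B} {b} (M⊆⟨B⟩ {b} (proj₂ gen {b}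
           (Span⇒⟨⟩ (∈⇒Span {A = H} {b} (lose b∈bs λ _ → refl))))))
  ... | inj₁ b∈B = resp B (λ x → sym (a≈b x)) b∈B
  ... | inj₂ s   = contradiction
    (Span-bind (λ e (e∈B , e≉b) → ∈⇒Span (∈-delete⁺ {a = b} {e} {bs} (B⊆H {e} e∈B , e≉b))) s)
    (irredundant b b∈bs)

-- Permutations

open Inverse using () renaming (to to infix 8 _⟨$⟩_ ; from to infix 8 _⟨$⟩⁻¹_)

swap : ℕ → ℕ → ℕ → ℕ
swap a b i with i ℕ.≟ a | i ℕ.≟ b
... | yes _ | _     = b
... | no _  | yes _ = a
... | no _  | no _  = i

swap-matchˡ : ∀ a b → swap a b a ≡ b
swap-matchˡ a b with a ℕ.≟ a
... | yes _  = refl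
... | no a≢a = contradiction refl a≢a

swap-matchʳ : ∀ a b → swap a b b ≡ a
swap-matchʳ a b with b ℕ.≟ a | b ℕ.≟ b
... | yes b≡a | _      = b≡a
... | no _    | yes _  = refl
... | no _    | no b≢b = contradiction refl b≢b

swap-mismatch : ∀ a b i → i ≢ a → i ≢ b → swap a b i ≡ i
swap-mismatch a b i i≢a i≢b with i ℕ.≟ a | i ℕ.≟ b
... | yes i≡a | _       = contradiction i≡a i≢a
... | no _    | yes i≡b = contradiction i≡b i≢b
... | no _    | no _    = refl

swap-involutive : ∀ a b i → swap a b (swap a b i) ≡ i
swap-involutive a b i with i ℕ.≟ a | i ℕ.≟ b
... | yes refl | _        = swap-matchʳ a b
... | no _     | yes refl = swap-matchˡ a b
... | no i≢a   | no i≢b   = swap-mismatch a b i i≢a i≢b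

transposition : ℕ → ℕ → ℕ ↔ ℕ
transposition a b = mk↔ₛ′ (swap a b) (swap a b) (swap-involutive a b) (swap-involutive a b)

↔-injective : ∀ (σ : ℕ ↔ ℕ) {i j} → σ ⟨$⟩ i ≡ σ ⟨$⟩ j → i ≡ j
↔-injective σ {i} {j} eq =
  trans (sym (Inverse.strictlyInverseʳ σ i)) (trans (cong (σ ⟨$⟩⁻¹_) eq) (Inverse.strictlyInverseʳ σ j))

transposition-Sym : ∀ {n a b} → a < n → b < n → Sym[ n ] (transposition a b)
transposition-Sym a<n b<n i n≤i = swap-mismatch _ _ i
  (λ { refl → ℕ.<⇒≱ a<n n≤i }) (λ { refl → ℕ.<⇒≱ b<n n≤i })

Sym-∘ : ∀ {n} σ τ → Sym[ n ] σ → Sym[ n ] τ → Sym[ n ] (σ ↔-∘ τ)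
Sym-∘ σ τ σ∈ τ∈ i n≤i = trans (cong (σ ⟨$⟩_) (τ∈ i n≤i)) (σ∈ i n≤i)

Sym-⁻¹ : ∀ {n} σ → Sym[ n ] σ → Sym[ n ] (↔-sym σ)
Sym-⁻¹ σ σ∈ i n≤i = trans (cong (σ ⟨$⟩⁻¹_) (sym (σ∈ i n≤i))) (Inverse.strictlyInverseʳ σ i)

Sym-mono : ∀ {m n} σ → m ≤ n → Sym[ m ] σ → Sym[ n ] σ
Sym-mono σ m≤n σ∈ i n≤i = σ∈ i (ℕ.≤-trans m≤n n≤i)

-- If `σ` sent `i` to a value at least `n`, it would fix that value, and injectivity would make it
-- equal to `i`.
Sym-preserves-< : ∀ {n} σ → Sym[ n ] σ → ∀ {i} → i < n → σ ⟨$⟩ i < n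
Sym-preserves-< {n} σ σ∈ {i} i<n with σ ⟨$⟩ i <? n
... | yes σi<n = σi<n
... | no  σi≮n = contradiction
  (subst (n ≤_) (↔-injective σ (σ∈ _ (ℕ.≮⇒≥ σi≮n))) (ℕ.≮⇒≥ σi≮n)) (ℕ.<⇒≱ i<n)

-- Positions are corrected one at a time by a transposition after `τ` that carries `τ t` to `σ t`.
-- Injectivity of `τ` and of `σ` keeps it from disturbing the values at other positions already
-- matched.
restrict-to-Sym : ∀ {n} (σ : ℕ ↔ ℕ) ts → (∀ {i} → i ∈ˡ ts → i < n × σ ⟨$⟩ i < n) →
                  ∃[ τ ] Sym[ n ] τ × (∀ {i} → i ∈ˡ ts → τ ⟨$⟩ i ≡ σ ⟨$⟩ i)
restrict-to-Sym σ [] _ = ↔-id ℕ , (λ _ _ → refl) , λ ()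
restrict-to-Sym {n} σ (t ∷ ts) within with τ , τ∈ , agree ← restrict-to-Sym σ ts (within ∘ there) =
  transposition (τ ⟨$⟩ t) (σ ⟨$⟩ t) ↔-∘ τ ,
  Sym-∘ (transposition (τ ⟨$⟩ t) (σ ⟨$⟩ t)) τ
    (transposition-Sym (Sym-preserves-< τ τ∈ (proj₁ (within (here refl)))) (proj₂ (within (here refl)))) τ∈ ,
  agree′
  where
  agree′ : ∀ {i} → i ∈ˡ t ∷ ts → swap (τ ⟨$⟩ t) (σ ⟨$⟩ t) (τ ⟨$⟩ i) ≡ σ ⟨$⟩ i
  agree′ (here refl) = swap-matchˡ (τ ⟨$⟩ t) _
  agree′ {i} (there i∈) with i ℕ.≟ t
  ... | yes refl = swap-matchˡ (τ ⟨$⟩ t) _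
  ... | no i≢t   = trans (swap-mismatch _ _ _ (i≢t ∘ ↔-injective τ)
    (λ eq → i≢t (↔-injective σ (trans (sym (agree i∈)) eq)))) (agree i∈)

-- The positions in `ts` already have values below `length ts`. If the new `t` has a larger value
-- than `length ts`, that value is swapped with `length ts`, which moves none of the others.
compress : ∀ {n} ts → length ts ≤ n → (∀ {i} → i ∈ˡ ts → i < n) →
           ∃[ σ ] Sym[ n ] σ × (∀ {i} → i ∈ˡ ts → σ ⟨$⟩ i < length ts)
compress [] _ _ = ↔-id ℕ , (λ _ _ → refl) , λ ()
compress {n} (t ∷ ts) len within with compress ts (ℕ.<⇒≤ len) (within ∘ there)
... | σ , σ∈ , small with σ ⟨$⟩ t ≤? length ts
...   | yes σt≤ = σ , σ∈ , λ { (here refl) → s≤s σt≤ ; (there i∈) → ℕ.m<n⇒m<1+n (small i∈) }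
...   | no  σt≰ =
  transposition (σ ⟨$⟩ t) (length ts) ↔-∘ σ ,
  Sym-∘ (transposition (σ ⟨$⟩ t) (length ts)) σ
    (transposition-Sym (Sym-preserves-< σ σ∈ (within (here refl))) len) σ∈ ,
  small′
  where
  small′ : ∀ {i} → i ∈ˡ t ∷ ts → swap (σ ⟨$⟩ t) (length ts) (σ ⟨$⟩ i) < suc (length ts)
  small′ (here refl) rewrite swap-matchˡ (σ ⟨$⟩ t) (length ts) = ℕ.≤-refl
  small′ {i} (there i∈) rewrite swap-mismatch (σ ⟨$⟩ t) (length ts) (σ ⟨$⟩ i)
    (λ eq → σt≰ (subst (_≤ length ts) eq (ℕ.<⇒≤ (small i∈)))) (ℕ.<⇒≢ (small i∈)) = ℕ.m<n⇒m<1+n (small i∈)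

-- Every σ ∈ Sym(n+1) is the transposition of n and σ(n) after an element of Sym(n).
allSym : ℕ → List (ℕ ↔ ℕ)
allSym zero    = ↔-id ℕ ∷ []
allSym (suc n) = cartesianProductWith (λ j τ → transposition n j ↔-∘ τ) (upTo (suc n)) (allSym n)

allSym-sound : ∀ n {σ} → σ ∈ˡ allSym n → Sym[ n ] σ
allSym-sound zero    (here refl) _ _ = refl
allSym-sound (suc n) σ∈
  with j , τ , j∈ , τ∈ , refl ←
    ∈-cartesianProductWith⁻ (λ j τ → transposition n j ↔-∘ τ) (upTo (suc n)) (allSym n) σ∈ =
  Sym-∘ (transposition n j) τ (transposition-Sym ℕ.≤-refl (∈-upTo⁻ j∈))
    (Sym-mono τ (ℕ.n≤1+n n) (allSym-sound n τ∈))

-- Agreement is pointwise, which suffices because the action on a vector depends only on the values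
-- of the permutation.
allSym-complete : ∀ n σ → Sym[ n ] σ → ∃[ τ ] τ ∈ˡ allSym n × (∀ i → τ ⟨$⟩ i ≡ σ ⟨$⟩ i)
allSym-complete zero σ σ∈ = ↔-id ℕ , here refl , λ i → sym (σ∈ i z≤n)
allSym-complete (suc n) σ σ∈ =
  let τ , τ∈ , agree = allSym-complete n (transposition n (σ ⟨$⟩ n) ↔-∘ σ) fixes in
  transposition n (σ ⟨$⟩ n) ↔-∘ τ ,
  ∈-cartesianProductWith⁺ (λ j τ → transposition n j ↔-∘ τ)
    (∈-upTo⁺ (Sym-preserves-< σ σ∈ ℕ.≤-refl)) τ∈ ,
  λ i → trans (cong (swap n (σ ⟨$⟩ n)) (agree i)) (swap-involutive n (σ ⟨$⟩ n) _)
  where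
  fixes : Sym[ n ] (transposition n (σ ⟨$⟩ n) ↔-∘ σ)
  fixes i n≤i with ℕ.m≤n⇒m<n∨m≡n n≤i
  ... | inj₂ refl = swap-matchʳ n (σ ⟨$⟩ n)
  ... | inj₁ n<i  = trans (cong (swap n (σ ⟨$⟩ n)) (σ∈ i n<i)) (swap-mismatch n (σ ⟨$⟩ n) i
    (λ { refl → ℕ.<-irrefl refl n<i })
    (λ i≡σn → ℕ.<-irrefl (sym (↔-injective σ (trans (σ∈ i n<i) i≡σn))) n<i))

-- The action on vectors

permute-cong : ∀ {f g : ℕ → ℕ} (x : Index c d) → (∀ {i} → i ∈ˡ toList (proj₁ x) → f i ≡ g i) →
               permute f x ≡ permute g x
permute-cong {f = f} {g} (is , j) agree = cong (_, j) (go is agree)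
  where
  go : ∀ {m} (is : Vec ℕ m) → (∀ {i} → i ∈ˡ toList is → f i ≡ g i) → Vec.map f is ≡ Vec.map g is
  go []       _     = refl
  go (i ∷ is) agree = cong₂ _∷_ (agree (here refl)) (go is (agree ∘ there))

Below⇒< : ∀ {n} (x : Index c d) → Below n x → ∀ {i} → i ∈ˡ toList (proj₁ x) → i < n
Below⇒< (i ∷ is , j) (i<n Allᵛ.∷ _) (here refl) = i<n
Below⇒< (i ∷ is , j) (_ Allᵛ.∷ b)   (there i∈)  = Below⇒< (is , j) b i∈

<⇒Below-permute : ∀ {n} (f : ℕ → ℕ) (x : Index c d) →
                  (∀ {i} → i ∈ˡ toList (proj₁ x) → f i < n) → Below n (permute f x)
<⇒Below-permute f ([] , j)     _  = Allᵛ.[]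
<⇒Below-permute f (i ∷ is , j) f< = f< (here refl) Allᵛ.∷ <⇒Below-permute f (is , j) (f< ∘ there)

Below-permute⇒< : ∀ {n} (f : ℕ → ℕ) (x : Index c d) → Below n (permute f x) →
                  ∀ {i} → i ∈ˡ toList (proj₁ x) → f i < n
Below-permute⇒< f (i ∷ is , j) (fi<n Allᵛ.∷ _) (here refl) = fi<n
Below-permute⇒< f (i ∷ is , j) (_ Allᵛ.∷ b)    (there i∈)  = Below-permute⇒< f (is , j) b i∈

-- Supports and the positions they involve

∈-bound : ∀ (u : Vector c d) {x} → coeff u x ≢ 0ℤ → x ∈ˡ bound u
∈-bound u {x} ux≢0 with x ∈? bound u
... | yes x∈ = x∈
... | no  x∉ = contradiction (vanishes u x x∉) ux≢0

∈-support⁺ : ∀ (u : Vector c d) {x} → coeff u x ≢ 0ℤ → x ∈ˡ support u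
∈-support⁺ u ux≢0 =
  ∈-deduplicate⁺ _≟ᴵ_ (∈-filter⁺ (λ y → ¬? (coeff u y ℤ.≟ 0ℤ)) (∈-bound u ux≢0) ux≢0)

∈-support⁻ : ∀ (u : Vector c d) {x} → x ∈ˡ support u → coeff u x ≢ 0ℤ
∈-support⁻ u x∈ = proj₂ (∈-filter⁻ (λ y → ¬? (coeff u y ℤ.≟ 0ℤ)) {xs = bound u} (∈-deduplicate⁻ _≟ᴵ_ _ x∈))

-- Removing the head of `xs` from `ys` shortens `ys` and, by uniqueness, still leaves the tail of
-- `xs` inside it.
Unique-length : ∀ {xs ys : List (Index c d)} → Unique xs → (∀ {x} → x ∈ˡ xs → x ∈ˡ ys) → length xs ≤ length ys
Unique-length []                 _     = z≤n
Unique-length {xs = x ∷ xs} {ys} (x∉ ∷ uniq) xs⊆ys = ℕ.≤-<-trans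
  (Unique-length uniq λ {y} y∈ → ∈-filter⁺ ≢x? (xs⊆ys (there y∈)) λ y≡x → All.lookup x∉ y∈ (sym y≡x))
  (filter-notAll ≢x? ys (lose (xs⊆ys (here refl)) λ x≢x → x≢x refl))
  where
  ≢x? : ∀ y → Dec (y ≢ x)
  ≢x? y = ¬? (y ≟ᴵ x)

supportSize-≤ : ∀ (u : Vector c d) xs → (∀ x → coeff u x ≢ 0ℤ → x ∈ˡ xs) → supportSize u ≤ length xs
supportSize-≤ u xs ⊆xs = Unique-length (deduplicate-! _≟ᴵ_ _) λ {x} x∈ → ⊆xs x (∈-support⁻ u x∈)

-- Repetitions are kept, so the length is exactly `supportSize u * d`. The vector `act σ u` depends
-- on `σ` only through these positions.
positions : Vector c d → List ℕ
positions u = concatMap (toList ∘ proj₁) (support u)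

∈-positions⁺ : ∀ (u : Vector c d) {x i} → coeff u x ≢ 0ℤ → i ∈ˡ toList (proj₁ x) → i ∈ˡ positions u
∈-positions⁺ u ux≢0 i∈ = ∈-concatMap⁺ (toList ∘ proj₁) (lose (∈-support⁺ u ux≢0) i∈)

∈-positions⁻ : ∀ (u : Vector c d) {i} → i ∈ˡ positions u → ∃[ x ] coeff u x ≢ 0ℤ × i ∈ˡ toList (proj₁ x)
∈-positions⁻ u i∈ with x , x∈ , i∈x ← find (∈-concatMap⁻ (toList ∘ proj₁) i∈) = x , ∈-support⁻ u x∈ , i∈x

length-positions : ∀ (u : Vector c d) → length (positions u) ≡ supportSize u * d
length-positions {d = d} u = go (support u)
  where
  go : ∀ xs → length (concatMap (toList ∘ proj₁) xs) ≡ length xs * d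
  go []       = refl
  go (x ∷ xs) = trans (length-++ (toList (proj₁ x))) (cong₂ _+_ (Vec.length-toList (proj₁ x)) (go xs))

-- Dependence of the action on the permutation

act-inverse : ∀ σ (u : Vector c d) → act σ (act (↔-sym σ) u) ≈ u
act-inverse σ u x = cong (coeff u) (permute-inverse (Inverse.strictlyInverseˡ σ) x)

act-inverse′ : ∀ σ (u : Vector c d) → act (↔-sym σ) (act σ u) ≈ u
act-inverse′ σ u x = cong (coeff u) (permute-inverse (Inverse.strictlyInverseʳ σ) x)

act-id : (u : Vector c d) → u ≈ act (↔-id ℕ) u
act-id u (is , j) = cong (λ is → coeff u (is , j)) (sym (Vec.map-id is))

-- The preimages of `x` under `σ` and `τ` may differ as long as `u` vanishes at both; if `u` is
-- nonzero at one of them, agreement on the support forces them to coincide.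
act-agree : ∀ σ τ (u : Vector c d) →
            (∀ y → coeff u y ≢ 0ℤ → permute (σ ⟨$⟩_) y ≡ permute (τ ⟨$⟩_) y) → act σ u ≈ act τ u
act-agree σ τ u agree x
  with coeff u (permute (σ ⟨$⟩⁻¹_) x) ℤ.≟ 0ℤ | coeff u (permute (τ ⟨$⟩⁻¹_) x) ℤ.≟ 0ℤ
... | yes p | yes q = trans p (sym q)
... | no p  | _     = cong (coeff u) (trans
  (sym (permute-inverse (Inverse.strictlyInverseʳ τ) _))
  (cong (permute (τ ⟨$⟩⁻¹_)) (trans (sym (agree _ p)) (permute-inverse (Inverse.strictlyInverseˡ σ) x))))
... | yes _ | no q  = sym (cong (coeff u) (trans
  (sym (permute-inverse (Inverse.strictlyInverseʳ σ) _))
  (cong (permute (σ ⟨$⟩⁻¹_)) (trans (agree _ q) (permute-inverse (Inverse.strictlyInverseˡ τ) x)))))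

act-support : ∀ σ (u : Vector c d) y → coeff u y ≢ 0ℤ → coeff (act σ u) (permute (σ ⟨$⟩_) y) ≢ 0ℤ
act-support σ u y uy≢0 eq =
  uy≢0 (trans (sym (cong (coeff u) (permute-inverse (Inverse.strictlyInverseʳ σ) y))) eq)

act-within : ∀ {n} σ (u : Vector c d) → u ∈ ℤ^I[ n ] → act σ u ∈ ℤ^I[ n ] →
             ∃[ τ ] Sym[ n ] τ × act σ u ≈ act τ u
act-within σ u u∈ σu∈ =
  let τ , τ∈ , agree = restrict-to-Sym σ (positions u) within in
  τ , τ∈ , act-agree σ τ u λ y uy≢0 →
    permute-cong y λ i∈ → sym (agree (∈-positions⁺ u {y} uy≢0 i∈))
  where
  within : ∀ {i} → i ∈ˡ positions u → i < _ × σ ⟨$⟩ i < _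
  within i∈ with x , ux≢0 , i∈x ← ∈-positions⁻ u i∈ =
    Below⇒< x (u∈ x ux≢0) i∈x ,
    Below-permute⇒< (σ ⟨$⟩_) x (σu∈ _ (act-support σ u x ux≢0)) i∈x

act-compress : ∀ {p n} (u : Vector c d) → supportSize u * d ≤ p → p ≤ n → u ∈ ℤ^I[ n ] →
               ∃[ σ ] Sym[ n ] σ × act σ u ∈ ℤ^I[ p ]
act-compress {p = p} {n} u size≤p p≤n u∈ =
  let σ , σ∈ , small = compress (positions u) (ℕ.≤-trans len≤p p≤n) within in
  σ , σ∈ , λ x σux≢0 → subst (Below p) (permute-inverse (Inverse.strictlyInverseˡ σ) x)
    (<⇒Below-permute (σ ⟨$⟩_) (permute (σ ⟨$⟩⁻¹_) x) λ i∈ →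
      ℕ.<-≤-trans (small (∈-positions⁺ u {permute (σ ⟨$⟩⁻¹_) x} σux≢0 i∈)) len≤p)
  where
  len≤p : length (positions u) ≤ p
  len≤p = subst (_≤ p) (sym (length-positions u)) size≤p
  within : ∀ {i} → i ∈ˡ positions u → i < n
  within i∈ with x , ux≢0 , i∈x ← ∈-positions⁻ u i∈ = Below⇒< x (u∈ x ux≢0) i∈x

-- A splitting of `b` in `M` is pulled back along the inverse of `σ` to a splitting of `a`.
Irreducible-act : ∀ {M : Subset c d} σ → (∀ w → w ∈ M → act (↔-sym σ) w ∈ M) →
                  ∀ {a b} → b ≈ act σ a → Irreducible M a → Irreducible M b
Irreducible-act {M = M} σ inv {a} {b} b≈ irr = record
  { nonzero = λ b≈0 → nonzero irr λ x → trans (a≈ x) (b≈0 _)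
  ; split   = λ u v u∈ v∈ b≈u⊕v → [ inj₁ ∘ undo u , inj₂ ∘ undo v ]′
      (split irr (act (↔-sym σ) u) (act (↔-sym σ) v) (inv u u∈) (inv v v∈)
        λ x → trans (a≈ x) (b≈u⊕v _))
  }
  where
  a≈ : a ≈ act (↔-sym σ) b
  a≈ x = trans (sym (act-inverse′ σ a x)) (sym (b≈ _))
  undo : ∀ u → act (↔-sym σ) u ≈ 𝟎 → u ≈ 𝟎
  undo u eq x = trans (sym (act-inverse σ u x)) (eq _)

-- Orbits

act∈orbit : ∀ {G : Pred (ℕ ↔ ℕ) 0ℓ} {H : Subset c d} σ h → G σ → h ∈ H → act σ h ∈ G ⟪ H ⟫
act∈orbit σ h σ∈ h∈ = σ , h , σ∈ , h∈ , λ _ → refl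

⊆orbit : ∀ n {H : Subset c d} h → h ∈ H → h ∈ Sym[ n ] ⟪ H ⟫
⊆orbit n h h∈ = ↔-id ℕ , h , (λ _ _ → refl) , h∈ , act-id h

finite-orbit : ∀ n (H : Subset c d) → Finite H → Finite (Sym[ n ] ⟪ H ⟫)
finite-orbit n H (hs , H⊆hs , hs⊆H) =
  cartesianProductWith act (allSym n) hs , (λ {v} → to {v}) , (λ {v} → from {v})
  where
  to : Sym[ n ] ⟪ H ⟫ ⊆ fromList (cartesianProductWith act (allSym n) hs)
  to {v} (σ , u , σ∈ , u∈ , v≈)
    with h , h∈ , u≈h ← find (H⊆hs {u} u∈) | τ , τ∈ , agree ← allSym-complete n σ σ∈ =
    lose (∈-cartesianProductWith⁺ act τ∈ h∈) λ x → trans (v≈ x) (trans (u≈h _)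
      (act-agree σ τ h (λ y _ → permute-cong y λ {i} _ → sym (agree i)) x))
  from : fromList (cartesianProductWith act (allSym n) hs) ⊆ Sym[ n ] ⟪ H ⟫
  from {v} v∈ with w , w∈ , v≈w ← find v∈
    with τ , h , τ∈ , h∈ , refl ← ∈-cartesianProductWith⁻ act (allSym n) hs w∈ =
    τ , h , allSym-sound n τ∈ , hs⊆H {h} (lose h∈ λ _ → refl) , v≈w

-- The summands of a nonnegative vector supported in I_n are supported in I_n, so
-- the permutations moving H to them may be taken in Sym(n).
localize : ∀ {n} {G : Pred (ℕ ↔ ℕ) 0ℓ} {H : Subset c d} →
           (∀ h → h ∈ H → h ∈ ℤ≥0^I ∩ ℤ^I[ n ]) →
           ∀ {u} → u ∈ ℤ^I[ n ] → Span (G ⟪ H ⟫) u → Span (Sym[ n ] ⟪ H ⟫) u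
localize H⊆ u∈ (nil u≈0) = nil u≈0
localize {n = n} {G} {H} H⊆ {u} u∈ (cons a v (σ , h , σ∈ , h∈ , a≈) s u≈) =
  let τ , τ∈ , σh≈τh = act-within σ h (proj₂ (H⊆ h h∈))
        (resp ℤ^I[ n ] {a} {act σ h} a≈ (summandˡ-bounded a v u a≥0 v≥0 u≈ u∈))
  in cons a v (τ , h , τ∈ , h∈ , λ x → trans (a≈ x) (σh≈τh x))
       (localize {H = H} H⊆ (summandʳ-bounded a v u a≥0 v≥0 u≈ u∈) s) u≈
  where
  orbit≥0 : ∀ b → b ∈ G ⟪ H ⟫ → b ∈ ℤ≥0^I
  orbit≥0 b (τ , g , _ , g∈ , b≈) x = subst (0ℤ ≤ᶻ_) (sym (b≈ x)) (proj₁ (H⊆ g g∈) _)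
  a≥0 : a ∈ ℤ≥0^I
  a≥0 = orbit≥0 a (σ , h , σ∈ , h∈ , a≈)
  v≥0 : v ∈ ℤ≥0^I
  v≥0 = Span-nonneg orbit≥0 s

uniform-bound : ∀ {X : Set} {P : ℕ → X → Set} → (∀ {m n x} → m ≤ n → P m x → P n x) →
                ∀ {xs} → All (λ x → ∃[ n ] P n x) xs → ∃[ n ] 1 ≤ n × All (P n) xs
-- The default is 1 rather than 0 because chain indices and support bounds must be positive.
uniform-bound mono []              = 1 , ℕ.≤-refl , []
uniform-bound mono ((m , px) ∷ ps) =
  let n , 1≤n , pxs = uniform-bound mono ps in
  m ⊔ n , ℕ.m≤n⇒m≤o⊔n m 1≤n , mono (ℕ.m≤m⊔n m n) px ∷ All.map (mono (ℕ.m≤n⊔m m n)) pxs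

-- The list `bound h` contains the support, and the action maps it to a list of the same length; so
-- its length bounds support sizes along the whole orbit.
orbit-supportSize : ∀ (H : Subset c d) → Finite H →
  ∃[ q ] 1 ≤ q × (∀ {G : Pred (ℕ ↔ ℕ) 0ℓ} a → a ∈ G ⟪ H ⟫ → supportSize a ≤ q)
orbit-supportSize H (hs , H⊆hs , _) =
  let q , 1≤q , small = uniform-bound {P = λ n h → length (bound h) ≤ n}
        (λ m≤n l≤m → ℕ.≤-trans l≤m m≤n) {hs} (All.universal (λ h → length (bound h) , ℕ.≤-refl) hs)
  in q , 1≤q , λ {G} → lemma {G} small
  where
  lemma : ∀ {G : Pred (ℕ ↔ ℕ) 0ℓ} {q} → All (λ h → length (bound h) ≤ q) hs →
          ∀ a → a ∈ G ⟪ H ⟫ → supportSize a ≤ q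
  lemma small a (σ , u , _ , u∈ , a≈) with h , h∈ , u≈h ← find (H⊆hs {u} u∈) = ℕ.≤-trans
    (supportSize-≤ a (bound (act σ h)) λ x ax≢0 →
      ∈-bound (act σ h) λ eq → ax≢0 (trans (a≈ x) (trans (u≈h _) eq)))
    (ℕ.≤-trans (ℕ.≤-reflexive (length-map (permute (σ ⟨$⟩_)) (bound h))) (All.lookup small h∈))

-- Chains of nonnegative monoids

-- Each of the four conditions is shown to be equivalent to this one.
record StableBasis (M : ℕ → Subset c d) : Set₁ where
  field
    p           : ℕ
    1≤p         : 1 ≤ p
    H           : Subset c d
    finite      : Finite H
    included    : ∀ h → h ∈ H → h ∈ M p
    irreducible : ∀ h → h ∈ H → Irreducible (⋃ M) h
    spans       : ∀ n → p ≤ n → ∀ u → u ∈ M n → Span (Sym[ n ] ⟪ H ⟫) u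

module Chain {c d : ℕ} (M : ℕ → Subset c d) (chain : IsSymInvariantChain M)
             (nonneg : ∀ n → 1 ≤ n → M n ⊆ ℤ≥0^I ∩ ℤ^I[ n ]) where
  open IsSymInvariantChain chain

  M≥0 : ∀ n → 1 ≤ n → ∀ u → u ∈ M n → u ∈ ℤ≥0^I
  M≥0 n 1≤n u u∈ = proj₁ (nonneg n 1≤n {u} u∈)

  ⋃≥0 : ∀ u → u ∈ ⋃ M → u ∈ ℤ≥0^I
  ⋃≥0 u (n , 1≤n , u∈) = M≥0 n 1≤n u u∈

  act-closed : ∀ {n} → 1 ≤ n → ∀ σ → Sym[ n ] σ → ∀ u → u ∈ M n → act σ u ∈ M n
  act-closed {n} 1≤n σ σ∈ u u∈ = invariant n 1≤n {act σ u} (act∈orbit {H = M n} σ u σ∈ u∈)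

  orbit⊆M : ∀ {n} → 1 ≤ n → (H : Subset c d) → (∀ h → h ∈ H → h ∈ M n) →
            ∀ u → u ∈ Sym[ n ] ⟪ H ⟫ → u ∈ M n
  orbit⊆M {n} 1≤n H H⊆M u (σ , h , σ∈ , h∈ , u≈) = invariant n 1≤n {u} (σ , h , σ∈ , H⊆M h h∈ , u≈)

  ⋃-act-closed : ∀ {k} σ → Sym[ k ] σ → ∀ u → u ∈ ⋃ M → act σ u ∈ ⋃ M
  ⋃-act-closed {k} σ σ∈ u (n , 1≤n , u∈) =
    n ⊔ k , 1≤n⊔k ,
    act-closed 1≤n⊔k σ (Sym-mono σ (ℕ.m≤n⊔m n k) σ∈) u (monotone n (n ⊔ k) 1≤n (ℕ.m≤m⊔n n k) {u} u∈)
    where 1≤n⊔k = ℕ.m≤n⇒m≤n⊔o k 1≤n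

  ⋃-isMonoid : IsMonoid (⋃ M)
  ⋃-isMonoid = record
    { 𝟎-mem    = 1 , ℕ.≤-refl , IsMonoid.𝟎-mem (isMonoid 1 ℕ.≤-refl)
    ; ⊕-closed = λ {u} {v} (m , 1≤m , u∈) (n , 1≤n , v∈) →
        m ⊔ n , ℕ.m≤n⇒m≤n⊔o n 1≤m ,
        IsMonoid.⊕-closed (isMonoid (m ⊔ n) (ℕ.m≤n⇒m≤n⊔o n 1≤m))
          (monotone m (m ⊔ n) 1≤m (ℕ.m≤m⊔n m n) {u} u∈)
          (monotone n (m ⊔ n) 1≤n (ℕ.m≤n⊔m m n) {v} v∈)
    }

  -- The substantial inclusion of (iii)(a); the other one follows from `bounded`.
  Saturated : ℕ → Set
  Saturated n = ∀ u → u ∈ ⋃ M → u ∈ ℤ^I[ n ] → u ∈ M n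

  -- Summands of `a` taken from the union are supported in I_n, so saturation brings them back into
  -- `M n`.
  Irreducible-⋃ : ∀ {n} → 1 ≤ n → Saturated n → ∀ a → a ∈ M n → Irreducible (M n) a → Irreducible (⋃ M) a
  Irreducible-⋃ {n} 1≤n sat a a∈ irr = record
    { nonzero = nonzero irr
    ; split   = λ u v u∈ v∈ a≈ → split irr u v
        (sat u u∈ (summandˡ-bounded u v a (⋃≥0 u u∈) (⋃≥0 v v∈) a≈ (bounded n 1≤n {a} a∈)))
        (sat v v∈ (summandʳ-bounded u v a (⋃≥0 u u∈) (⋃≥0 v v∈) a≈ (bounded n 1≤n {a} a∈)))
        a≈
    }

  -- An element of the union lies in a possibly larger `M (k ⊔ n)` and is a sum over orbits of `H`
  -- there. If it is supported in I_n, `localize` turns these into orbits under Sym(n), which stay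
  -- in `M n`.
  stable-saturated : ∀ {p} → 1 ≤ p → (H : Subset c d) → (∀ h → h ∈ H → h ∈ M p) →
    (∀ n → p ≤ n → ∀ u → u ∈ M n → Span (Sym[ n ] ⟪ H ⟫) u) → ∀ n → p ≤ n → Saturated n
  stable-saturated {p} 1≤p H H⊆Mp spans n p≤n u (k , 1≤k , u∈) u∈I =
    Span-⊆ {M = M n} (isMonoid n 1≤n) (orbit⊆M 1≤n H H⊆Mn)
      (localize {G = Sym[ k ⊔ n ]} {H} (λ h h∈ → nonneg n 1≤n {h} (H⊆Mn h h∈)) u∈I
        (spans (k ⊔ n) (ℕ.≤-trans p≤n (ℕ.m≤n⊔m k n)) u
          (monotone k (k ⊔ n) 1≤k (ℕ.m≤m⊔n k n) {u} u∈)))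
    where
    1≤n = ℕ.≤-trans 1≤p p≤n
    H⊆Mn : ∀ h → h ∈ H → h ∈ M n
    H⊆Mn h h∈ = monotone p n 1≤p p≤n {h} (H⊆Mp h h∈)

  -- From a stable basis to the four conditions

  module FromStableBasis (S : StableBasis M) where
    open StableBasis S

    module _ {n} (p≤n : p ≤ n) where
      1≤n : 1 ≤ n
      1≤n = ℕ.≤-trans 1≤p p≤n

      H⊆Mn : ∀ h → h ∈ H → h ∈ M n
      H⊆Mn h h∈ = monotone p n 1≤p p≤n {h} (included h h∈)

      orbit-generates : Generates (Sym[ n ] ⟪ H ⟫) (M n)
      orbit-generates = (λ {u} u∈ → Span⇒⟨⟩ (spans n p≤n u u∈))
        , (λ {u} u∈ → Span-⊆ {M = M n} (isMonoid n 1≤n) (orbit⊆M 1≤n H H⊆Mn)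
             (⟨⟩⇒Span {A = Sym[ n ] ⟪ H ⟫} {u} u∈))

      orbit-irreducible : ∀ a → a ∈ Sym[ n ] ⟪ H ⟫ → Irreducible (⋃ M) a
      orbit-irreducible a (σ , h , σ∈ , h∈ , a≈) =
        Irreducible-act σ (⋃-act-closed (↔-sym σ) (Sym-⁻¹ σ σ∈)) a≈ (irreducible h h∈)

      orbit-hilbertBasis : IsHilbertBasis (Sym[ n ] ⟪ H ⟫) (M n)
      orbit-hilbertBasis = irreducible⇒hilbertBasis (isMonoid n 1≤n) orbit-generates
        λ a a∈ → Irreducible-⊆ {M = ⋃ M} (λ u u∈ → n , 1≤n , u∈) (orbit-irreducible a a∈)

    stabilizes : Stabilizes M
    stabilizes = p , 1≤p , λ m n p≤m m≤n →
      let p≤n = ℕ.≤-trans p≤m m≤n ; 1≤m = ℕ.≤-trans 1≤p p≤m in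
        (λ {u} u∈ → Span⇒⟨⟩ (Span-bind {B = Sym[ n ] ⟪ M m ⟫}
           (λ { a (σ , h , σ∈ , h∈ , a≈) → ∈⇒Span (σ , h , σ∈ , H⊆Mn p≤m h h∈ , a≈) })
           (spans n p≤n u u∈)))
      , (λ {u} u∈ → Span-⊆ {M = M n} (isMonoid n (1≤n p≤n))
           (orbit⊆M (1≤n p≤n) (M m) λ h → monotone m n 1≤m m≤n {h})
           (⟨⟩⇒Span {A = Sym[ n ] ⟪ M m ⟫} {u} u∈))

    eventuallyFinitelyGenerated : EventuallyFinitelyGenerated M
    eventuallyFinitelyGenerated = p , 1≤p , λ n p≤n →
      Sym[ n ] ⟪ H ⟫ , finite-orbit n H finite , orbit-generates p≤n

    stableEquivariantHilbertBasis : StableEquivariantHilbertBasis M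
    stableEquivariantHilbertBasis = p , 1≤p , H , finite , basis p ℕ.≤-refl , basis
      where
      basis : ∀ n → p ≤ n → IsEquivariantHilbertBasis Sym[ n ] H (M n)
      basis n p≤n = record { included = λ {h} → H⊆Mn p≤n h ; hilbertBasis = orbit-hilbertBasis p≤n }

    saturatedWithBoundedSupport : SaturatedWithBoundedSupport M
    saturatedWithBoundedSupport =
      let q′ , 1≤q′ , small = orbit-supportSize H finite in
      p , q′ , 1≤p , 1≤q′ , λ n p≤n →
        ((λ {u} u∈ → (n , 1≤n p≤n , u∈) , bounded n (1≤n p≤n) {u} u∈)
        , (λ {u} (u∈ , u∈I) → stable-saturated 1≤p H included spans n p≤n u u∈ u∈I))
      , Sym[ n ] ⟪ H ⟫ , finite-orbit n H finite , orbit-hilbertBasis p≤n , small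

    finiteEquivariantHilbertBasis : FiniteEquivariantHilbertBasis (⋃ M)
    finiteEquivariantHilbertBasis = H , finite , record
      { included     = λ {h} h∈ → p , 1≤p , included h h∈
      ; hilbertBasis = irreducible⇒hilbertBasis ⋃-isMonoid gen irr
      }
      where
      gen : Generates (Sym ⟪ H ⟫) (⋃ M)
      -- Passing to `n ⊔ p` reaches the range in which the orbits of `H` are known to span.
      gen = (λ {u} (n , 1≤n , u∈) → Span⇒⟨⟩ (Span-bind {B = Sym ⟪ H ⟫}
               (λ { a (σ , h , σ∈ , h∈ , a≈) →
                    ∈⇒Span (σ , h , (n ⊔ p , ℕ.m≤n⇒m≤n⊔o p 1≤n , σ∈) , h∈ , a≈) })
               (spans (n ⊔ p) (ℕ.m≤n⊔m n p) u (monotone n (n ⊔ p) 1≤n (ℕ.m≤m⊔n n p) {u} u∈))))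
          , (λ {u} u∈ → Span-⊆ {M = ⋃ M} ⋃-isMonoid
               (λ { a (σ , h , (k , _ , σ∈) , h∈ , a≈) →
                    resp (⋃ M) {act σ h} {a} (λ x → sym (a≈ x))
                      (⋃-act-closed σ σ∈ h (p , 1≤p , included h h∈)) })
               (⟨⟩⇒Span {A = Sym ⟪ H ⟫} {u} u∈))
      irr : ∀ a → a ∈ Sym ⟪ H ⟫ → Irreducible (⋃ M) a
      irr a (σ , h , (k , _ , σ∈) , h∈ , a≈) =
        Irreducible-act σ (⋃-act-closed (↔-sym σ) (Sym-⁻¹ σ σ∈)) a≈ (irreducible h h∈)

  -- From each of the four conditions to a stable basis

  fromStabilizes : Stabilizes M → EventuallyFinitelyGenerated M → StableBasis M
  fromStabilizes (p , 1≤p , stab) (N , _ , fg)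
    with H , finite , hb ← finitelyGenerated⇒finiteHilbertBasis
           (M≥0 (p ⊔ N) (ℕ.m≤n⇒m≤n⊔o N 1≤p)) (fg (p ⊔ N) (ℕ.m≤n⊔m p N)) = record
    { p = m ; 1≤p = 1≤m ; H = H ; finite = finite
    ; included    = H⊆M
    ; irreducible = λ h h∈ → Irreducible-⋃ 1≤m saturated h (H⊆M h h∈)
                      (hilbertBasis-irreducible (M≥0 m 1≤m) hb h h∈)
    ; spans       = λ n m≤n u u∈ → Span-bind {B = Sym[ n ] ⟪ H ⟫} (orbit-spans n) (stabSpans n m≤n u u∈)
    }
    where
    -- From this index on the chain both is stable and has finitely generated members.
    m = p ⊔ N
    1≤m = ℕ.m≤n⇒m≤n⊔o N 1≤p

    stabSpans : ∀ n → m ≤ n → ∀ u → u ∈ M n → Span (Sym[ n ] ⟪ M m ⟫) u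
    stabSpans n m≤n u u∈ = ⟨⟩⇒Span (proj₁ (stab m n (ℕ.m≤m⊔n p N) m≤n) {u} u∈)

    saturated : Saturated m
    -- The whole of `M m` serves as the generating set here, which need not be finite.
    saturated = stable-saturated 1≤m (M m) (λ _ → id) stabSpans m ℕ.≤-refl

    H⊆M : ∀ h → h ∈ H → h ∈ M m
    H⊆M h h∈ = proj₂ (IsHilbertBasis.generates hb) {h} (Span⇒⟨⟩ (∈⇒Span {A = H} h∈))

    -- The action is additive, so an expression over `H` is translated term by term.
    act-span : ∀ n σ → Sym[ n ] σ → ∀ {u} → Span H u → Span (Sym[ n ] ⟪ H ⟫) (act σ u)
    act-span n σ σ∈ (nil u≈0) = nil λ x → u≈0 _
    act-span n σ σ∈ (cons a v a∈ s u≈) = cons (act σ a) (act σ v)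
      (act∈orbit {H = H} σ a σ∈ a∈) (act-span n σ σ∈ s) λ x → u≈ _

    orbit-spans : ∀ n a → a ∈ Sym[ n ] ⟪ M m ⟫ → Span (Sym[ n ] ⟪ H ⟫) a
    orbit-spans n a (σ , u , σ∈ , u∈ , a≈) = Span-resp {u = act σ u} (λ x → sym (a≈ x))
      (act-span n σ σ∈ (⟨⟩⇒Span {A = H} {u} (proj₁ (IsHilbertBasis.generates hb) {u} u∈)))

  fromStableEquivariantHilbertBasis : StableEquivariantHilbertBasis M → StableBasis M
  fromStableEquivariantHilbertBasis (p , 1≤p , H , finite , _ , basis) = record
    { p = p ; 1≤p = 1≤p ; H = H ; finite = finite
    ; included    = H⊆Mp
    -- Since `H` lies in its own orbit, its elements belong to a Hilbert basis of `M p` and are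
    -- irreducible there; saturation extends this to the union.
    ; irreducible = λ h h∈ → Irreducible-⋃ 1≤p (stable-saturated 1≤p H H⊆Mp spans p ℕ.≤-refl) h (H⊆Mp h h∈)
        (hilbertBasis-irreducible (M≥0 p 1≤p) (hilbertBasis (basis p ℕ.≤-refl)) h (⊆orbit p {H} h h∈))
    ; spans       = spans
    }
    where
    open IsEquivariantHilbertBasis
    H⊆Mp : ∀ h → h ∈ H → h ∈ M p
    H⊆Mp h = included (basis p ℕ.≤-refl) {h}
    spans : ∀ n → p ≤ n → ∀ u → u ∈ M n → Span (Sym[ n ] ⟪ H ⟫) u
    spans n p≤n u u∈ = ⟨⟩⇒Span (proj₁ (IsHilbertBasis.generates (hilbertBasis (basis n p≤n))) {u} u∈)

  fromSaturated : SaturatedWithBoundedSupport M → StableBasis M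
  fromSaturated (q , q′ , 1≤q , _ , cond) = record
    { p = p ; 1≤p = 1≤p
    ; H           = H
    ; finite      = proj₁ (proj₂ (proj₂ (cond p q≤p)))
    ; included    = basis⊆M p q≤p
    ; irreducible = λ h h∈ → Irreducible-⋃ 1≤p saturated h (basis⊆M p q≤p h h∈) (basisIrreducible p q≤p h h∈)
    ; spans       = λ n p≤n u u∈ → Span-bind {B = Sym[ n ] ⟪ H ⟫} (λ a a∈ → ∈⇒Span (inOrbit n p≤n a a∈))
                      (basisSpans n (ℕ.≤-trans q≤p p≤n) u u∈)
    }
    where
    -- Large enough for both conditions of (iii) to hold, and for all positions of a vector of
    -- support size at most `q′` to fit into [p].
    p = q ⊔ q′ * d
    q≤p = ℕ.m≤m⊔n q (q′ * d)
    1≤p = ℕ.≤-trans 1≤q q≤p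

    basisOf : ∀ n → q ≤ n → Subset c d
    basisOf n q≤n = proj₁ (proj₂ (cond n q≤n))

    H = basisOf p q≤p

    isBasis : ∀ n q≤n → IsHilbertBasis (basisOf n q≤n) (M n)
    isBasis n q≤n = proj₁ (proj₂ (proj₂ (proj₂ (cond n q≤n))))

    basisSpans : ∀ n q≤n u → u ∈ M n → Span (basisOf n q≤n) u
    basisSpans n q≤n u u∈ = ⟨⟩⇒Span (proj₁ (IsHilbertBasis.generates (isBasis n q≤n)) {u} u∈)

    basis⊆M : ∀ n q≤n a → a ∈ basisOf n q≤n → a ∈ M n
    basis⊆M n q≤n a a∈ = proj₂ (IsHilbertBasis.generates (isBasis n q≤n)) {a}
      (Span⇒⟨⟩ (∈⇒Span {A = basisOf n q≤n} a∈))

    basisIrreducible : ∀ n q≤n a → a ∈ basisOf n q≤n → Irreducible (M n) a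
    basisIrreducible n q≤n = hilbertBasis-irreducible (M≥0 n (ℕ.≤-trans 1≤q q≤n)) (isBasis n q≤n)

    saturated : Saturated p
    saturated u u∈ u∈I = proj₂ (proj₁ (cond p q≤p)) {u} (u∈ , u∈I)

    -- A basis element of M_n involves at most q′·d ≤ p positions, so a permutation moves it into
    -- M ∩ ℤ^(I_p) = M_p, where irreducibility forces it to be a basis element.
    inOrbit : ∀ n → (p≤n : p ≤ n) → ∀ a → a ∈ basisOf n (ℕ.≤-trans q≤p p≤n) → a ∈ Sym[ n ] ⟪ H ⟫
    inOrbit n p≤n a a∈ =
      let σ , σ∈ , σa∈I = act-compress a
            (ℕ.≤-trans (ℕ.*-monoˡ-≤ d (proj₂ (proj₂ (proj₂ (proj₂ (cond n q≤n)))) a a∈)) (ℕ.m≤n⊔m q _))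
            p≤n (bounded n 1≤n {a} a∈M)
          σa∈Mn = act-closed 1≤n σ σ∈ a a∈M
          irr = Irreducible-act {M = M n} σ (act-closed 1≤n (↔-sym σ) (Sym-⁻¹ σ σ∈)) {a} {act σ a}
                  (λ _ → refl) (basisIrreducible n q≤n a a∈)
          σa∈H = irreducible-generator (isMonoid p 1≤p) {H} (basis⊆M p q≤p) (act σ a)
                   (Irreducible-⊆ {M = M n} (λ u → monotone p n 1≤p p≤n {u}) irr)
                   (basisSpans p q≤p (act σ a) (saturated (act σ a) (n , 1≤n , σa∈Mn) σa∈I))
      in ↔-sym σ , act σ a , Sym-⁻¹ σ σ∈ , σa∈H , λ x → sym (act-inverse′ σ a x)
      where
      q≤n = ℕ.≤-trans q≤p p≤n
      1≤n = ℕ.≤-trans 1≤p p≤n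
      a∈M = basis⊆M n q≤n a a∈

  -- Finiteness of `H` places it in a single `M p`; then `localize` replaces orbits under Sym by
  -- orbits under Sym(n) for every `n ≥ p`.
  fromFiniteEquivariantHilbertBasis : FiniteEquivariantHilbertBasis (⋃ M) → StableBasis M
  fromFiniteEquivariantHilbertBasis (H , (hs , H⊆hs , hs⊆H) , basis)
    with p , 1≤p , hs⊆Mp ← uniform-bound {P = λ n h → 1 ≤ n × h ∈ M n}
           (λ {m} {n} {h} m≤n (1≤m , h∈) → ℕ.≤-trans 1≤m m≤n , monotone m n 1≤m m≤n {h} h∈) {hs}
           (All.tabulate λ {h} h∈ → IsEquivariantHilbertBasis.included basis {h} (hs⊆H {h} (lose h∈ λ _ → refl))) =
    record
    { p = p ; 1≤p = 1≤p ; H = H ; finite = hs , H⊆hs , hs⊆H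
    ; included    = H⊆Mp hs⊆Mp
    ; irreducible = λ h h∈ → hilbertBasis-irreducible ⋃≥0 hilbertBasis h
        (↔-id ℕ , h , (1 , ℕ.≤-refl , λ _ _ → refl) , h∈ , act-id h)
    ; spans       = λ n p≤n u u∈ →
        let 1≤n = ℕ.≤-trans 1≤p p≤n in
        localize {G = Sym} {H}
          (λ h h∈ → nonneg n 1≤n {h} (monotone p n 1≤p p≤n {h} (H⊆Mp hs⊆Mp h h∈)))
          (bounded n 1≤n {u} u∈)
          (⟨⟩⇒Span (proj₁ (IsHilbertBasis.generates hilbertBasis) {u} (n , 1≤n , u∈)))
    }
    where
    open IsEquivariantHilbertBasis basis using (hilbertBasis)
    H⊆Mp : ∀ {p} → All (λ h → 1 ≤ p × h ∈ M p) hs → ∀ h → h ∈ H → h ∈ M p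
    H⊆Mp {p} hs⊆ h h∈ with g , g∈ , h≈g ← find (H⊆hs {h} h∈) =
      resp (M p) (λ x → sym (h≈g x)) (proj₂ (All.lookup hs⊆ g∈))

  -- Equivalence of each condition with the existence of a stable basis

  stabilizes⇔stableBasis : (Stabilizes M × EventuallyFinitelyGenerated M) ⇔ StableBasis M
  stabilizes⇔stableBasis = mk⇔ (λ (stab , fg) → fromStabilizes stab fg)
    λ S → FromStableBasis.stabilizes S , FromStableBasis.eventuallyFinitelyGenerated S

  equivariant⇔stableBasis : StableEquivariantHilbertBasis M ⇔ StableBasis M
  equivariant⇔stableBasis =
    mk⇔ fromStableEquivariantHilbertBasis FromStableBasis.stableEquivariantHilbertBasis

  saturated⇔stableBasis : SaturatedWithBoundedSupport M ⇔ StableBasis M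
  saturated⇔stableBasis = mk⇔ fromSaturated FromStableBasis.saturatedWithBoundedSupport

  finite⇔stableBasis : FiniteEquivariantHilbertBasis (⋃ M) ⇔ StableBasis M
  finite⇔stableBasis =
    mk⇔ fromFiniteEquivariantHilbertBasis FromStableBasis.finiteEquivariantHilbertBasis

theorem3p14 : (c d : ℕ) → 1 ≤ c → 1 ≤ d →
    (M : ℕ → Subset c d) → IsSymInvariantChain M →
    (∀ n → 1 ≤ n → M n ⊆ ℤ≥0^I ∩ ℤ^I[ n ]) →
    ((Stabilizes M × EventuallyFinitelyGenerated M) ⇔ StableEquivariantHilbertBasis M)
    × (StableEquivariantHilbertBasis M ⇔ SaturatedWithBoundedSupport M)
    × (SaturatedWithBoundedSupport M ⇔ FiniteEquivariantHilbertBasis (⋃ M))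
theorem3p14 c d _ _ M chain nonneg =
    ⇔-sym equivariant⇔stableBasis ⇔-∘ stabilizes⇔stableBasis
  , ⇔-sym saturated⇔stableBasis ⇔-∘ equivariant⇔stableBasis
  , ⇔-sym finite⇔stableBasis ⇔-∘ saturated⇔stableBasis
  where open Chain M chain nonneg
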